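{- The first-order theory of (co)datatypes (with the standard semantics for selectors) is undecidable: there is no algorithm that, given a (co)datatype signature and a first-order sentence over it, decides whether the sentence is true in every structure of (co)datatypes for that signature.
   Context: A (co)datatype signature consists of a set of sorts $S = S_{dt} \cup S_{ct}$ partitioned into datatypes $S_{dt}$ and codatatypes $S_{ct}$, and function symbols partitioned into constructors and selectors; there are no predicate symbols. Each (co)datatype $\delta$ has $m \ge 1$ constructors $C_1,\dots,C_m$; each constructor $C$ has an arity $\delta_1 \times \cdots \times \delta_n \to \delta$ and comes with $n$ selectors $\mathrm{sel}_C^j : \delta \to \delta_j$ ($j=1,\dots,n$). All constructor arguments of a datatype are datatypes and all constructor arguments of a codatatype are codatatypes. Datatypes are well-founded: every datatype has a ground constructor term. A constructor tree of sort $\delta$ is a (possibly infinite) rooted ordered tree whose root is labeled by a constructor $C:\delta_1\times\cdots\times\delta_n\to\delta$ and whose $n$ children, in order, are roots of constructor trees of sorts $\delta_1,\dots,\delta_n$. A structure of (co)datatypes interprets each codatatype $\gamma$ as the set of all constructor trees of sort $\gamma$, each datatype $\delta$ as the set of finite constructor trees of sort $\delta$, each constructor $C$ as the map sending $(t_1,\dots,t_n)$ to the tree with root labeled $C$ and subtrees $t_1,\dots,t_n$, and each selector $\mathrm{sel}_C^i$ as some function satisfying $\mathrm{sel}_C^i(C(t_1,\dots,t_n)) = t_i$; its values on trees whose root is not $C$ are arbitrary (standard semantics). The theory of (co)datatypes is the set of sentences true in every structure of (co)datatypes. -}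

module Defs where

open import Data.Nat using (ℕ; zero; suc; _+_; _<_; _<?_)
open import Data.Fin using (Fin; toℕ; fromℕ<)
import Data.Fin as Fin
open import Data.Bool using (Bool; true; false)
open import Data.List using (List; []; _∷_; length; map)
import Data.List as List
open import Data.Vec using (Vec; lookup)
import Data.Vec as Vec
open import Data.Maybe using (Maybe; just; nothing)
open import Data.Product using (Σ; _×_; _,_; proj₁; proj₂; ∃)
open import Data.Unit using (⊤; tt)
open import Relation.Nullary using (¬_; yes; no)
open import Relation.Binary.PropositionalEquality using (_≡_; refl; subst; trans; cong)
open import Data.Empty using (⊥-elim)
open import Function using (case_of_)
open import Data.List.Membership.Propositional using (_∈_)
open import Data.Fin.Properties using (fromℕ<-toℕ; toℕ<n; toℕ-fromℕ<)
open import Data.List using (concatMap; allFin)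
import Data.List.Relation.Unary.Any as Any
open import Data.List.Membership.Propositional.Properties using (∈-map⁺; ∈-concatMap⁺; ∈-allFin)

-- (Co)datatype signatures
--
-- Sorts are Fin nsorts.  isCo s = true  iff  s is a codatatype.
-- ctors s is the list of constructors of sort s; each constructor is
-- given by its list of argument sorts  δ₁ … δₙ  (so C : δ₁ × … × δₙ → s).
-- Constructor C (index c) of sort s with n arguments comes with the
-- n selectors sel_C^j, j : Fin n; they are not listed separately.

record Sig : Set where
  field
    nsorts : ℕ
    isCo   : Vec Bool nsorts
    ctors  : Vec (List (List (Fin nsorts))) nsorts

data SExp : Set where
  atom : ℕ → SExp
  node : List SExp → SExp

module _ (sig : Sig) where
  open Sig sig

  Sort : Set
  Sort = Fin nsorts

  Ctor : Sort → Set
  Ctor s = Fin (length (lookup ctors s))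

  Args : (s : Sort) → Ctor s → List Sort
  Args s c = List.lookup (lookup ctors s) c

  Arg : (s : Sort) (c : Ctor s) → Fin (length (Args s c)) → Sort
  Arg s c j = List.lookup (Args s c) j

  data GroundTerm (s : Sort) : Set where
    gcon : (c : Ctor s) → ((j : Fin (length (Args s c))) → GroundTerm (Arg s c j)) → GroundTerm s

  record WF : Set where
    field
      nonempty   : ∀ s → 0 < length (lookup ctors s)
      coherent   : ∀ s c j → lookup isCo (Arg s c j) ≡ lookup isCo s
      wellFounded : ∀ s → lookup isCo s ≡ false → GroundTerm s

  -- Constructor trees (possibly infinite), represented by their labelling
  -- of positions.  A position is a path of child indices from the root;
  -- l p is the (index of the) constructor labelling the node at p.

  nC : Sort → ℕ
  nC s = length (lookup ctors s)

  arity : (s : Sort) → Ctor s → ℕ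
  arity s c = length (Args s c)

  toCtor : (s : Sort) → ℕ → Maybe (Ctor s)
  toCtor s n with n <? nC s
  ... | yes lt = just (fromℕ< lt)
  ... | no _   = nothing

  -- sortAt s l p = just a  iff  p is a node of the tree l of sort s and
  -- that node has sort a
  mutual
    sortAt : Sort → (List ℕ → ℕ) → List ℕ → Maybe Sort
    sortAt s l []      = just s
    sortAt s l (k ∷ p) = sortAtKid s (toCtor s (l [])) (λ q → l (k ∷ q)) k p

    sortAtKid : (s : Sort) → Maybe (Ctor s) → (List ℕ → ℕ) → ℕ → List ℕ → Maybe Sort
    sortAtKid s nothing  l k p = nothing
    sortAtKid s (just c) l k p with k <? arity s c
    ... | yes lk = sortAt (Arg s c (fromℕ< lk)) l p
    ... | no _   = nothing

  IsTree : Sort → (List ℕ → ℕ) → Set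
  IsTree s l = ∀ p a → sortAt s l p ≡ just a → l p < nC a

  Tree : Sort → Set
  Tree s = Σ (List ℕ → ℕ) (IsTree s)

  IsNode : {s : Sort} → Tree s → List ℕ → Set
  IsNode {s} t p = ∃ λ a → sortAt s (proj₁ t) p ≡ just a

  _≈_ : {s : Sort} → Tree s → Tree s → Set
  t ≈ u = (∀ p → IsNode t p → proj₁ t p ≡ proj₁ u p)
        × (∀ p → IsNode u p → proj₁ u p ≡ proj₁ t p)

  Finite : {s : Sort} → Tree s → Set
  Finite t = ∃ λ (ps : List (List ℕ)) → ∀ p → IsNode t p → p ∈ ps

  mkl : {s : Sort} (c : Ctor s) → ((j : Fin (arity s c)) → Tree (Arg s c j)) → List ℕ → ℕ
  mkl c ts [] = toℕ c
  mkl {s} c ts (k ∷ p) with k <? arity s c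
  ... | yes lk = proj₁ (ts (fromℕ< lk)) p
  ... | no _   = 0

  mkl-node : {s : Sort} (c : Ctor s) (ts : (j : Fin (arity s c)) → Tree (Arg s c j))
             → ∀ k q a → sortAt s (mkl c ts) (k ∷ q) ≡ just a
             → Σ (k < arity s c) λ lk → sortAt (Arg s c (fromℕ< lk)) (proj₁ (ts (fromℕ< lk))) q ≡ just a
  toCtor-toℕ : (s : Sort) (c : Ctor s) → toCtor s (toℕ c) ≡ just c
  toCtor-toℕ s c with toℕ c <? nC s
  ... | yes lt = cong just (fromℕ<-toℕ c lt)
  ... | no ¬lt = ⊥-elim (¬lt (toℕ<n c))

  mkl-node {s} c ts k q a e rewrite toCtor-toℕ s c with k <? arity s c
  ... | no _   = case e of λ ()
  ... | yes lk = lk , e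

  mk : {s : Sort} (c : Ctor s) → ((j : Fin (arity s c)) → Tree (Arg s c j)) → Tree s
  mk {s} c ts = mkl c ts , isT
    where
    isT : IsTree s (mkl c ts)
    isT [] a refl = toℕ<n c
    isT (k ∷ q) a e with mkl-node c ts k q a e
    ... | lk , e′ with k <? arity s c
    ...   | yes lk′ = proj₂ (ts (fromℕ< lk′)) q a e′
    ...   | no ¬lk  = ⊥-elim (¬lk lk)

  mk-finite : {s : Sort} (c : Ctor s) (ts : (j : Fin (arity s c)) → Tree (Arg s c j))
              → (∀ j → Finite (ts j)) → Finite (mk c ts)
  mk-finite {s} c ts fs = ps , mem
    where
    f : Fin (arity s c) → List (List ℕ)
    f j = map (toℕ j ∷_) (proj₁ (fs j))
    ps : List (List ℕ)
    ps = [] ∷ concatMap f (allFin (arity s c))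
    mem : ∀ p → IsNode (mk c ts) p → p ∈ ps
    mem [] _ = Any.here refl
    mem (k ∷ q) (a , e) with mkl-node c ts k q a e
    ... | lk , e′ = Any.there (∈-concatMap⁺ f (Any.map (λ { refl → m }) (∈-allFin (fromℕ< lk))))
      where
      m : k ∷ q ∈ map (toℕ (fromℕ< lk) ∷_) (proj₁ (fs (fromℕ< lk)))
      m = subst (λ k′ → k′ ∷ q ∈ map (toℕ (fromℕ< lk) ∷_) (proj₁ (fs (fromℕ< lk))))
                (toℕ-fromℕ< lk)
                (∈-map⁺ (toℕ (fromℕ< lk) ∷_) (proj₂ (fs (fromℕ< lk)) q (a , e′)))

  DomB : Bool → Set → Set
  DomB true  _ = ⊤
  DomB false A = A

  InDom : (s : Sort) → Tree s → Set
  InDom s t = DomB (lookup isCo s) (Finite t)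

  Dom : Sort → Set
  Dom s = Σ (Tree s) (InDom s)

  -- Structures of (co)datatypes: the carriers and constructors are
  -- fixed; only the selectors vary (standard semantics).

  record Structure : Set where
    field
      selI    : (s : Sort) (c : Ctor s) (j : Fin (length (Args s c)))
                → (t : Tree s) → InDom s t → Tree (Arg s c j)
      sel-dom : ∀ s c j t (d : InDom s t) → InDom (Arg s c j) (selI s c j t d)
      sel-resp : ∀ s c j t u (d : InDom s t) (e : InDom s u) → t ≈ u → selI s c j t d ≈ selI s c j u e
      sel-con : ∀ s c j ts (d : InDom s (mk c ts)) → selI s c j (mk c ts) d ≈ ts j

  Ctx : Set
  Ctx = List Sort

  data Var : Ctx → Sort → Set where
    vz : ∀ {Γ s} → Var (s ∷ Γ) s
    vs : ∀ {Γ s s′} → Var Γ s → Var (s′ ∷ Γ) s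

  mutual
    data Term (Γ : Ctx) : Sort → Set where
      var : ∀ {s} → Var Γ s → Term Γ s
      con : (s : Sort) (c : Ctor s) → Terms Γ (Args s c) → Term Γ s
      sel : (s : Sort) (c : Ctor s) (j : Fin (length (Args s c))) → Term Γ s → Term Γ (Arg s c j)

    data Terms (Γ : Ctx) : List Sort → Set where
      []  : Terms Γ []
      _∷_ : ∀ {s ss} → Term Γ s → Terms Γ ss → Terms Γ (s ∷ ss)

  -- formulas: equality, negation, conjunction, universal quantification
  -- (the other connectives and ∃ are classically definable from these)
  data Formula (Γ : Ctx) : Set where
    eq  : (s : Sort) → Term Γ s → Term Γ s → Formula Γ
    neg : Formula Γ → Formula Γ
    and : Formula Γ → Formula Γ → Formula Γ
    all : (s : Sort) → Formula (s ∷ Γ) → Formula Γ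

  Sentence : Set
  Sentence = Formula []

  module Semantics (wf : WF) (M : Structure) where
    open Structure M

    dom→fin : ∀ a (t : Tree a) → lookup isCo a ≡ false → InDom a t → Finite t
    dom→fin a t e d = subst (λ b → DomB b (Finite t)) e d

    con-dom : ∀ s (c : Ctor s) (ts : (j : Fin (arity s c)) → Tree (Arg s c j))
              → (∀ j → InDom (Arg s c j) (ts j)) → InDom s (mk c ts)
    con-dom s c ts ds with lookup isCo s in e
    ... | true  = tt
    ... | false = mk-finite c ts (λ j → dom→fin _ (ts j) (trans (WF.coherent wf s c j) e) (ds j))

    Env : Ctx → Set
    Env Γ = ∀ {s} → Var Γ s → Dom s

    extend : ∀ {Γ s} → Dom s → Env Γ → Env (s ∷ Γ)
    extend x ρ vz     = x
    extend x ρ (vs v) = ρ v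

    mutual
      eval : ∀ {Γ s} → Env Γ → Term Γ s → Dom s
      eval ρ (var v) = ρ v
      eval ρ (con s c as) =
        mk c (λ j → proj₁ (evals ρ as j)) , con-dom s c _ (λ j → proj₂ (evals ρ as j))
      eval ρ (sel s c j a) with eval ρ a
      ... | t , d = selI s c j t d , sel-dom s c j t d

      evals : ∀ {Γ ss} → Env Γ → Terms Γ ss → (j : Fin (length ss)) → Dom (List.lookup ss j)
      evals ρ (a ∷ as) Fin.zero    = eval ρ a
      evals ρ (a ∷ as) (Fin.suc j) = evals ρ as j

    Sat : ∀ {Γ} → Env Γ → Formula Γ → Set
    Sat ρ (eq s a b) = proj₁ (eval ρ a) ≈ proj₁ (eval ρ b)
    Sat ρ (neg φ)    = ¬ Sat ρ φ
    Sat ρ (and φ ψ)  = Sat ρ φ × Sat ρ ψ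
    Sat ρ (all s φ)  = (x : Dom s) → Sat (extend x ρ) φ

    empty : Env []
    empty ()

  Valid : WF → Sentence → Set
  Valid wf φ = (M : Structure) → Semantics.Sat wf M (Semantics.empty wf M) φ

  varIx : ∀ {Γ s} → Var Γ s → ℕ
  varIx vz     = 0
  varIx (vs v) = suc (varIx v)

  mutual
    encTerm : ∀ {Γ s} → Term Γ s → SExp
    encTerm (var v)       = node (atom 0 ∷ atom (varIx v) ∷ [])
    encTerm (con s c as)  = node (atom 1 ∷ atom (toℕ s) ∷ atom (toℕ c) ∷ node (encTerms as) ∷ [])
    encTerm (sel s c j a) = node (atom 2 ∷ atom (toℕ s) ∷ atom (toℕ c) ∷ atom (toℕ j) ∷ encTerm a ∷ [])

    encTerms : ∀ {Γ ss} → Terms Γ ss → List SExp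
    encTerms []       = []
    encTerms (a ∷ as) = encTerm a ∷ encTerms as

  encFormula : ∀ {Γ} → Formula Γ → SExp
  encFormula (eq s a b) = node (atom 0 ∷ atom (toℕ s) ∷ encTerm a ∷ encTerm b ∷ [])
  encFormula (neg φ)    = node (atom 1 ∷ encFormula φ ∷ [])
  encFormula (and φ ψ)  = node (atom 2 ∷ encFormula φ ∷ encFormula ψ ∷ [])
  encFormula (all s φ)  = node (atom 3 ∷ atom (toℕ s) ∷ encFormula φ ∷ [])

encBool : Bool → SExp
encBool false = atom 0
encBool true  = atom 1

encSig : Sig → SExp
encSig sig = node (atom nsorts
                 ∷ node (Vec.toList (Vec.map encBool isCo))
                 ∷ node (Vec.toList (Vec.map (λ cs → node (map (λ as → node (map (λ a → atom (toℕ a)) as)) cs)) ctors))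
                 ∷ [])
  where open Sig sig

tri : ℕ → ℕ
tri zero    = zero
tri (suc k) = suc k + tri k

pair : ℕ → ℕ → ℕ
pair a b = tri (a + b) + b

mutual
  gn : SExp → ℕ
  gn (atom n)  = pair 0 n
  gn (node xs) = pair 1 (gnList xs)

  gnList : List SExp → ℕ
  gnList []       = 0
  gnList (x ∷ xs) = suc (pair (gn x) (gnList xs))

code : (sig : Sig) → Sentence sig → ℕ
code sig φ = gn (node (encSig sig ∷ encFormula sig φ ∷ []))

data PRF : ℕ → Set where
  Z    : ∀ {n} → PRF n
  S    : PRF 1
  proj : ∀ {n} → Fin n → PRF n
  comp : ∀ {n m} → PRF m → Vec (PRF n) m → PRF n
  prec : ∀ {n} → PRF n → PRF (suc (suc n)) → PRF (suc n)
  mu   : ∀ {n} → PRF (suc n) → PRF n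

mutual
  data _[_]⇓_ : ∀ {n} → PRF n → Vec ℕ n → ℕ → Set where
    ev-Z     : ∀ {n} {xs : Vec ℕ n} → Z [ xs ]⇓ 0
    ev-S     : ∀ {x} → S [ x Vec.∷ Vec.[] ]⇓ suc x
    ev-proj  : ∀ {n} {xs : Vec ℕ n} (i : Fin n) → proj i [ xs ]⇓ lookup xs i
    ev-comp  : ∀ {n m} {f : PRF m} {gs : Vec (PRF n)  m} {xs ys y}
               → gs [ xs ]⇓* ys → f [ ys ]⇓ y → comp f gs [ xs ]⇓ y
    ev-prec0 : ∀ {n} {g : PRF n} {h} {xs y}
               → g [ xs ]⇓ y → prec g h [ 0 Vec.∷ xs ]⇓ y
    ev-precS : ∀ {n} {g : PRF n} {h} {xs k r y}
               → prec g h [ k Vec.∷ xs ]⇓ r → h [ k Vec.∷ r Vec.∷ xs ]⇓ y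
               → prec g h [ suc k Vec.∷ xs ]⇓ y
    ev-mu    : ∀ {n} {f : PRF (suc n)} {xs y}
               → f [ y Vec.∷ xs ]⇓ 0
               → (∀ z → z < y → ∃ λ k → f [ z Vec.∷ xs ]⇓ suc k)
               → mu f [ xs ]⇓ y

  data _[_]⇓*_ : ∀ {n m} → Vec (PRF n) m → Vec ℕ n → Vec ℕ m → Set where
    ev-nil  : ∀ {n} {xs : Vec ℕ n} → Vec.[] [ xs ]⇓* Vec.[]
    ev-cons : ∀ {n m} {g} {gs : Vec (PRF n) m} {xs y ys}
              → g [ xs ]⇓ y → gs [ xs ]⇓* ys → (g Vec.∷ gs) [ xs ]⇓* (y Vec.∷ ys)

DecidesTheory : PRF 1 → Set
DecidesTheory f = (sig : Sig) (wf : WF sig) (φ : Sentence sig)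
  → (Valid sig wf φ → f [ code sig φ Vec.∷ Vec.[] ]⇓ 1)
  × (¬ Valid sig wf φ → f [ code sig φ Vec.∷ Vec.[] ]⇓ 0)

{-# OPTIONS --safe #-}
module Submission where

-- In the datatype T = ∙ | ↑ T | T ▹ T the selector of ↑ is unconstrained on trees t ▹ c,
-- so validity quantifies over all binary functions R(t, c) := sel(t ▹ c) on finite trees.
-- Code the configurations of an abstract machine for partial recursive functions as trees
-- and let the equations R(↑ t, c) = R(t, c′), for the steps c → c′ of the machine, be axioms.
-- They entail ∃ t. R(t, c) = R(∙, c′) whenever the machine leads from c to c′, while the
-- function running the machine from c for t steps satisfies them and refutes such an
-- equation for distinct halting configurations c′.  Hence if G(n) = 0, the sentence
-- "axioms → ∃ t. R(t, init n) = R(∙, halt 0)" is valid, and if G(n) = 1, it is not.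
-- A decision procedure f composed with the map sending the code n of a formula to
-- the code of its instance at n gives a G for which the instance at its own code is
-- valid iff f rejects it.

open import Defs
open import Data.Bool using (false)
open import Data.Empty using (⊥)
open import Data.Fin using (Fin; zero; suc; toℕ)
open import Data.List using (List; []; _∷_; _++_; length; map; replicate)
open import Data.List.Membership.Propositional using (_∈_)
open import Data.List.Membership.Propositional.Properties using (∈-map⁺; ∈-++⁺ˡ; ∈-++⁺ʳ)
open import Data.List.Relation.Unary.Any using (here; there)
open import Data.Maybe using (just)
open import Data.Nat using (ℕ; zero; suc; _+_; _≤_; _<_; z≤n; s≤s; s<s⁻¹)
open import Data.Nat.ListAction using (sum)
open import Data.Nat.Properties using (≤-trans; m≤m+n; m≤n+m; +-suc; +-identityʳ)
open import Data.Product using (Σ; ∃; _×_; _,_; proj₁; proj₂)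
open import Data.Vec using (Vec; []; _∷_; lookup)
open import Relation.Nullary using (¬_)
open import Relation.Binary.PropositionalEquality using (_≡_; refl; sym; trans; cong; cong₂; subst)

-- Labellings and finite trees

infix  9 ↑_
infixr 5 _▹_

data T : Set where
  ∙   : T
  ↑_  : T → T
  _▹_ : T → T → T

pattern D  = Fin.zero
pattern c∙ = Fin.zero
pattern c↑ = Fin.suc Fin.zero
pattern c▹ = Fin.suc (Fin.suc Fin.zero)

treeSig : Sig
treeSig = record
  { nsorts = 1
  ; isCo   = false ∷ []
  ; ctors  = ([] ∷ (D ∷ []) ∷ (D ∷ D ∷ []) ∷ []) ∷ []
  }

treeWF : WF treeSig
treeWF = record
  { nonempty    = λ { D → s≤s z≤n }
  ; coherent    = λ { D c↑ zero → refl ; D c▹ zero → refl ; D c▹ (suc zero) → refl }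
  ; wellFounded = λ { D _ → gcon c∙ λ () }
  }

Labelling : Set
Labelling = List ℕ → ℕ

infix 9 _↓_
_↓_ : Labelling → ℕ → Labelling
(l ↓ k) p = l (k ∷ p)

Node : Labelling → List ℕ → Set
Node l p = ∃ λ a → sortAt treeSig D l p ≡ just a

-- Only the labels at the positions of the given tree are constrained. Off its nodes a labelling may
-- take any values, which `≈` ignores as well.
Rep : Labelling → T → Set
Rep l ∙       = l [] ≡ 0
Rep l (↑ x)   = l [] ≡ 1 × Rep (l ↓ 0) x
Rep l (x ▹ y) = l [] ≡ 2 × Rep (l ↓ 0) x × Rep (l ↓ 1) y

-- With a numeral in place of `l []`, `toCtor` computes, so each constructor case reduces.
sortAt-∷ : ∀ l {n} → l [] ≡ n → ∀ k p →
           sortAt treeSig D l (k ∷ p) ≡ sortAtKid treeSig D (toCtor treeSig D n) (l ↓ k) k p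
sortAt-∷ l e k p = cong (λ n → sortAtKid treeSig D (toCtor treeSig D n) (l ↓ k) k p) e

clash : ∀ {m n k : ℕ} → k ≡ m → k ≡ n → m ≡ n
clash e e′ = trans (sym e) e′

Rep-unique : ∀ x y l → Rep l x → Rep l y → x ≡ y
Rep-unique ∙       ∙         l _ _ = refl
Rep-unique ∙       (↑ _)     l e (e′ , _) with () ← clash e e′
Rep-unique ∙       (_ ▹ _)   l e (e′ , _) with () ← clash e e′
Rep-unique (↑ _)   ∙         l (e , _) e′ with () ← clash e e′
Rep-unique (↑ x)   (↑ y)     l (_ , r) (_ , r′) = cong ↑_ (Rep-unique x y (l ↓ 0) r r′)
Rep-unique (↑ _)   (_ ▹ _)   l (e , _) (e′ , _) with () ← clash e e′
Rep-unique (_ ▹ _) ∙         l (e , _) e′ with () ← clash e e′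
Rep-unique (_ ▹ _) (↑ _)     l (e , _) (e′ , _) with () ← clash e e′
Rep-unique (x ▹ y) (x′ ▹ y′) l (_ , r , s) (_ , r′ , s′) =
  cong₂ _▹_ (Rep-unique x x′ (l ↓ 0) r r′) (Rep-unique y y′ (l ↓ 1) s s′)

data Pos : T → List ℕ → Set where
  root  : ∀ {x} → Pos x []
  under : ∀ {x p} → Pos x p → Pos (↑ x) (0 ∷ p)
  left  : ∀ {x y p} → Pos x p → Pos (x ▹ y) (0 ∷ p)
  right : ∀ {x y p} → Pos y p → Pos (x ▹ y) (1 ∷ p)

Node⇒Pos : ∀ x l → Rep l x → ∀ p → Node l p → Pos x p
Node⇒Pos x l r [] _ = root
Node⇒Pos ∙ l e (k ∷ p) (a , n) with () ← trans (sym (sortAt-∷ l e k p)) n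
Node⇒Pos (↑ x) l (e , r) (zero ∷ p) (a , n) =
  under (Node⇒Pos x (l ↓ 0) r p (a , trans (sym (sortAt-∷ l e 0 p)) n))
Node⇒Pos (↑ x) l (e , r) (suc k ∷ p) (a , n) with () ← trans (sym (sortAt-∷ l e (suc k) p)) n
Node⇒Pos (x ▹ y) l (e , r , s) (zero ∷ p) (a , n) =
  left (Node⇒Pos x (l ↓ 0) r p (a , trans (sym (sortAt-∷ l e 0 p)) n))
Node⇒Pos (x ▹ y) l (e , r , s) (suc zero ∷ p) (a , n) =
  right (Node⇒Pos y (l ↓ 1) s p (a , trans (sym (sortAt-∷ l e 1 p)) n))
Node⇒Pos (x ▹ y) l (e , r , s) (suc (suc k) ∷ p) (a , n)
  with () ← trans (sym (sortAt-∷ l e (suc (suc k)) p)) n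

-- Paths off the tree also get labels below 3, so `IsTree` follows without tracking which paths are
-- nodes.
label : T → Labelling
label ∙       _             = 0
label (↑ x)   []            = 1
label (↑ x)   (_ ∷ p)       = label x p
label (x ▹ y) []            = 2
label (x ▹ y) (zero ∷ p)    = label x p
label (x ▹ y) (suc _ ∷ p)   = label y p

Rep-label : ∀ x → Rep (label x) x
Rep-label ∙       = refl
Rep-label (↑ x)   = refl , Rep-label x
Rep-label (x ▹ y) = refl , Rep-label x , Rep-label y

label<3 : ∀ x p → label x p < 3
label<3 ∙       _           = s≤s z≤n
label<3 (↑ x)   []          = s≤s (s≤s z≤n)
label<3 (↑ x)   (_ ∷ p)     = label<3 x p
label<3 (x ▹ y) []          = s≤s (s≤s (s≤s z≤n))
label<3 (x ▹ y) (zero ∷ p)  = label<3 x p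
label<3 (x ▹ y) (suc _ ∷ p) = label<3 y p

Rep⇒≡label : ∀ x l → Rep l x → ∀ {p} → Pos x p → l p ≡ label x p
Rep⇒≡label ∙       l e root = e
Rep⇒≡label (↑ x)   l (e , _) root = e
Rep⇒≡label (↑ x)   l (_ , r) (under q) = Rep⇒≡label x (l ↓ 0) r q
Rep⇒≡label (x ▹ y) l (e , _) root = e
Rep⇒≡label (x ▹ y) l (_ , r , s) (left q) = Rep⇒≡label x (l ↓ 0) r q
Rep⇒≡label (x ▹ y) l (_ , r , s) (right q) = Rep⇒≡label y (l ↓ 1) s q

positions : T → List (List ℕ)
positions ∙       = [] ∷ []
positions (↑ x)   = [] ∷ map (0 ∷_) (positions x)
positions (x ▹ y) = [] ∷ map (0 ∷_) (positions x) ++ map (1 ∷_) (positions y)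

Pos⇒∈ : ∀ x {p} → Pos x p → p ∈ positions x
Pos⇒∈ ∙       root      = here refl
Pos⇒∈ (↑ x)   root      = here refl
Pos⇒∈ (↑ x)   (under q) = there (∈-map⁺ (0 ∷_) (Pos⇒∈ x q))
Pos⇒∈ (x ▹ y) root      = here refl
Pos⇒∈ (x ▹ y) (left q)  = there (∈-++⁺ˡ (∈-map⁺ (0 ∷_) (Pos⇒∈ x q)))
Pos⇒∈ (x ▹ y) (right q) = there (∈-++⁺ʳ (map (0 ∷_) (positions x)) (∈-map⁺ (1 ∷_) (Pos⇒∈ y q)))

label-isTree : ∀ x → IsTree treeSig D (label x)
label-isTree x p D _ = label<3 x p

embed : T → Tree treeSig D
embed x = label x , label-isTree x

embed-finite : ∀ x → Finite treeSig (embed x)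
embed-finite x = positions x , λ p n → Pos⇒∈ x (Node⇒Pos x (label x) (Rep-label x) p n)

Rep⇒≈ : ∀ x (t u : Tree treeSig D) → Rep (proj₁ t) x → Rep (proj₁ u) x → _≈_ treeSig t u
Rep⇒≈ x (l , _) (m , _) r s = agree l m r s , agree m l s r
  where
  agree : ∀ l m → Rep l x → Rep m x → ∀ p → Node l p → l p ≡ m p
  agree l m r s p n =
    let q = Node⇒Pos x l r p n in trans (Rep⇒≡label x l r q) (sym (Rep⇒≡label x m s q))

Rep-resp : ∀ x l m → Rep l x → (∀ p → Node l p → l p ≡ m p) → Rep m x
Rep-resp ∙ l m e h = trans (sym (h [] (D , refl))) e
Rep-resp (↑ x) l m (e , r) h = trans (sym (h [] (D , refl))) e ,
  Rep-resp x (l ↓ 0) (m ↓ 0) r λ p (a , n) → h (0 ∷ p) (a , trans (sortAt-∷ l e 0 p) n)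
Rep-resp (x ▹ y) l m (e , r , s) h = trans (sym (h [] (D , refl))) e ,
  Rep-resp x (l ↓ 0) (m ↓ 0) r (λ p (a , n) → h (0 ∷ p) (a , trans (sortAt-∷ l e 0 p) n)) ,
  Rep-resp y (l ↓ 1) (m ↓ 1) s (λ p (a , n) → h (1 ∷ p) (a , trans (sortAt-∷ l e 1 p) n))

-- A labelling is a function and offers no structural recursion; the depth bound replaces it,
-- dropping by one in each subtree.
bounded⇒Rep : ∀ n l → IsTree treeSig D l → (∀ p → Node l p → length p < n) → ∃ (Rep l)
bounded⇒Rep zero l _ b with () ← b [] (D , refl)
bounded⇒Rep (suc n) l t b with l [] in e | t [] D refl
... | 0 | _ = ∙ , e
... | 1 | _ =
  let x , r = bounded⇒Rep n (l ↓ 0)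
                (λ p a q → t (0 ∷ p) a (trans (sortAt-∷ l e 0 p) q))
                (λ p (a , q) → s<s⁻¹ (b (0 ∷ p) (a , trans (sortAt-∷ l e 0 p) q)))
  in ↑ x , e , r
... | 2 | _ =
  let x , r = bounded⇒Rep n (l ↓ 0)
                (λ p a q → t (0 ∷ p) a (trans (sortAt-∷ l e 0 p) q))
                (λ p (a , q) → s<s⁻¹ (b (0 ∷ p) (a , trans (sortAt-∷ l e 0 p) q)))
      y , s = bounded⇒Rep n (l ↓ 1)
                (λ p a q → t (1 ∷ p) a (trans (sortAt-∷ l e 1 p) q))
                (λ p (a , q) → s<s⁻¹ (b (1 ∷ p) (a , trans (sortAt-∷ l e 1 p) q)))
  in (x ▹ y) , e , r , s
... | suc (suc (suc _)) | s≤s (s≤s (s≤s ()))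

length≤sum : ∀ {p : List ℕ} ps → p ∈ ps → length p ≤ sum (map length ps)
length≤sum (p ∷ ps) (here refl) = m≤m+n (length p) _
length≤sum (p ∷ ps) (there i)   = ≤-trans (length≤sum ps i) (m≤n+m _ (length p))

finite⇒Rep : (t : Tree treeSig D) → Finite treeSig t → ∃ (Rep (proj₁ t))
finite⇒Rep (l , t) (ps , f) =
  bounded⇒Rep (suc (sum (map length ps))) l t λ p n → s≤s (length≤sum ps (f p n))

reify : (t : Tree treeSig D) → Finite treeSig t → T
reify t f = proj₁ (finite⇒Rep t f)

Rep-reify : (t : Tree treeSig D) (f : Finite treeSig t) → Rep (proj₁ t) (reify t f)
Rep-reify t f = proj₂ (finite⇒Rep t f)

-- Formulas interpreted over T

Form : Ctx treeSig → Set
Form = Formula treeSig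

Tm : Ctx treeSig → Set
Tm Γ = Term treeSig Γ D

Selectors : Set
Selectors = (c : Ctor treeSig D) → Fin (arity treeSig D c) → T → T

EnvT : Ctx treeSig → Set
EnvT Γ = ∀ {s} → Var treeSig Γ s → T

_,ᵉ_ : ∀ {Γ s} → T → EnvT Γ → EnvT (s ∷ Γ)
(x ,ᵉ ρ) vz     = x
(x ,ᵉ ρ) (vs v) = ρ v

conT : ∀ s (c : Ctor treeSig s) → (Fin (arity treeSig s c) → T) → T
conT D c∙ xs = ∙
conT D c↑ xs = ↑ xs zero
conT D c▹ xs = xs zero ▹ xs (suc zero)

module TreeSemantics (I : Selectors) where

  mutual
    evalT : ∀ {Γ s} → EnvT Γ → Term treeSig Γ s → T
    evalT ρ (var v)       = ρ v
    evalT ρ (con s c as)  = conT s c (evalsT ρ as)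
    evalT ρ (sel D c j a) = I c j (evalT ρ a)

    evalsT : ∀ {Γ ss} → EnvT Γ → Terms treeSig Γ ss → Fin (length ss) → T
    evalsT ρ (a ∷ as) zero    = evalT ρ a
    evalsT ρ (a ∷ as) (suc j) = evalsT ρ as j

  SatT : ∀ {Γ} → EnvT Γ → Form Γ → Set
  SatT ρ (eq s a b) = evalT ρ a ≡ evalT ρ b
  SatT ρ (neg φ)    = ¬ SatT ρ φ
  SatT ρ (and φ ψ)  = SatT ρ φ × SatT ρ ψ
  SatT ρ (all s φ)  = ∀ x → SatT (x ,ᵉ ρ) φ

open TreeSemantics

emptyT : EnvT []
emptyT ()

singleT : T → EnvT (D ∷ [])
singleT x = x ,ᵉ emptyT

Rep-mk : ∀ s (c : Ctor treeSig s) ts xs → (∀ j → Rep (proj₁ (ts j)) (xs j)) →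
         Rep (mkl treeSig {s} c ts) (conT s c xs)
Rep-mk D c∙ ts xs r = refl
Rep-mk D c↑ ts xs r = refl , r zero
Rep-mk D c▹ ts xs r = refl , r zero , r (suc zero)

Interprets : Structure treeSig → Selectors → Set
Interprets M I = ∀ c j t d x → Rep (proj₁ t) x → Rep (proj₁ (Structure.selI M D c j t d)) (I c j x)

module Transfer (M : Structure treeSig) (I : Selectors) (MI : Interprets M I) where
  open Semantics treeSig treeWF M

  _∼_ : ∀ {Γ} → Env Γ → EnvT Γ → Set
  _∼_ {Γ} ρ σ = ∀ {s} (v : Var treeSig Γ s) → Rep (proj₁ (proj₁ (ρ v))) (σ v)

  mutual
    Rep-eval : ∀ {Γ s} (ρ : Env Γ) (σ : EnvT Γ) → ρ ∼ σ → (a : Term treeSig Γ s) →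
               Rep (proj₁ (proj₁ (eval ρ a))) (evalT I σ a)
    Rep-eval ρ σ r (var v)      = r v
    Rep-eval ρ σ r (con s c as) = Rep-mk s c _ _ (Rep-evals ρ σ r as)
    Rep-eval ρ σ r (sel D c j a) with eval ρ a | Rep-eval ρ σ r a
    ... | t , d | q = MI c j t d _ q

    Rep-evals : ∀ {Γ ss} (ρ : Env Γ) (σ : EnvT Γ) → ρ ∼ σ → (as : Terms treeSig Γ ss) →
                ∀ j → Rep (proj₁ (proj₁ (evals ρ as j))) (evalsT I σ as j)
    Rep-evals ρ σ r (a ∷ as) zero    = Rep-eval ρ σ r a
    Rep-evals ρ σ r (a ∷ as) (suc j) = Rep-evals ρ σ r as j

  ∼-extend : ∀ {Γ s} (ρ : Env Γ) (σ : EnvT Γ) → ρ ∼ σ → (d : Dom treeSig s) (x : T) →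
             Rep (proj₁ (proj₁ d)) x → extend d ρ ∼ (x ,ᵉ σ)
  ∼-extend ρ σ r d x q vz     = q
  ∼-extend ρ σ r d x q (vs v) = r v

  mutual
    -- Negation swaps the two directions, hence the mutual induction. Quantifiers pass through
    -- `embed` in this one and through `reify` in the other.
    Sat⇒SatT : ∀ {Γ} (ρ : Env Γ) (σ : EnvT Γ) → ρ ∼ σ → (φ : Form Γ) → Sat ρ φ → SatT I σ φ
    Sat⇒SatT ρ σ r (eq D a b) (h , _) =
      Rep-unique _ _ _ (Rep-resp _ _ _ (Rep-eval ρ σ r a) h) (Rep-eval ρ σ r b)
    Sat⇒SatT ρ σ r (neg φ) h = λ k → h (SatT⇒Sat ρ σ r φ k)
    Sat⇒SatT ρ σ r (and φ ψ) (h , k) = Sat⇒SatT ρ σ r φ h , Sat⇒SatT ρ σ r ψ k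
    Sat⇒SatT ρ σ r (all D φ) h = λ x → let d = embed x , embed-finite x in
      Sat⇒SatT (extend d ρ) (x ,ᵉ σ) (∼-extend ρ σ r d x (Rep-label x)) φ (h d)

    SatT⇒Sat : ∀ {Γ} (ρ : Env Γ) (σ : EnvT Γ) → ρ ∼ σ → (φ : Form Γ) → SatT I σ φ → Sat ρ φ
    SatT⇒Sat ρ σ r (eq D a b) h =
      Rep⇒≈ _ (proj₁ (eval ρ a)) (proj₁ (eval ρ b)) (Rep-eval ρ σ r a)
        (subst (Rep _) (sym h) (Rep-eval ρ σ r b))
    SatT⇒Sat ρ σ r (neg φ) h = λ k → h (Sat⇒SatT ρ σ r φ k)
    SatT⇒Sat ρ σ r (and φ ψ) (h , k) = SatT⇒Sat ρ σ r φ h , SatT⇒Sat ρ σ r ψ k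
    SatT⇒Sat ρ σ r (all D φ) h = λ { d@(t , f) →
      SatT⇒Sat (extend d ρ) (reify t f ,ᵉ σ) (∼-extend ρ σ r d _ (Rep-reify t f)) φ (h (reify t f)) }

-- Any structure induces selectors on `T`: embed, select, reify. By `sel-resp` the result does not
-- depend on the labelling representing the argument.
valid-intro : ∀ φ → (∀ I → SatT I emptyT φ) → Valid treeSig treeWF φ
valid-intro φ h M = Transfer.SatT⇒Sat M I MI (Semantics.empty treeSig treeWF M) emptyT (λ ()) φ (h I)
  where
  open Structure M
  selE : ∀ c j → T → Dom treeSig (Arg treeSig D c j)
  selE c j x = selI D c j (embed x) (embed-finite x) , sel-dom D c j (embed x) (embed-finite x)

  -- Stated for every sort, since `Arg treeSig D c j` does not reduce to `D` for variable `c` and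
  -- `j`.
  reifyS : ∀ s → Dom treeSig s → T
  reifyS D (t , f) = reify t f

  Rep-reifyS : ∀ s (d : Dom treeSig s) → Rep (proj₁ (proj₁ d)) (reifyS s d)
  Rep-reifyS D (t , f) = Rep-reify t f

  I : Selectors
  I c j x = reifyS _ (selE c j x)

  resp : ∀ s (t u : Tree treeSig s) x → _≈_ treeSig t u → Rep (proj₁ t) x → Rep (proj₁ u) x
  resp D t u x (h , _) r = Rep-resp x _ _ r h

  MI : Interprets M I
  MI c j t d x r = resp _ (proj₁ (selE c j x)) (selI D c j t d) _
    (sel-resp D c j (embed x) t (embed-finite x) d (Rep⇒≈ x (embed x) t (Rep-label x) r))
    (Rep-reifyS _ (selE c j x))

-- Structures with a prescribed selector of ↑

module Freely (R : T → T → T) where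

  -- Only the clause for `↑` is forced by the selector equation. The root `▹` packs the two
  -- arguments of `R`.
  down : T → T
  down ∙       = ∙
  down (↑ x)   = x
  down (t ▹ c) = R t c

  fst snd : T → T
  fst (x ▹ _) = x
  fst x       = x
  snd (_ ▹ y) = y
  snd y       = y

  selectors : Selectors
  selectors c↑ zero       = down
  selectors c▹ zero       = fst
  selectors c▹ (suc zero) = snd

  structure : Structure treeSig
  structure = record
    { selI     = λ { D c↑ zero t d       → embed (down (reify t d))
                   ; D c▹ zero t d       → embed (fst (reify t d))
                   ; D c▹ (suc zero) t d → embed (snd (reify t d)) }
    ; sel-dom  = λ { D c↑ zero t d       → embed-finite (down (reify t d))
                   ; D c▹ zero t d       → embed-finite (fst (reify t d))
                   ; D c▹ (suc zero) t d → embed-finite (snd (reify t d)) }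
    ; sel-resp = λ { D c↑ zero t u d e h       → resp down t u d e h
                   ; D c▹ zero t u d e h       → resp fst t u d e h
                   ; D c▹ (suc zero) t u d e h → resp snd t u d e h }
    ; sel-con  = λ { D c↑ zero ts d       → con↑ ts (reify (mk treeSig c↑ ts) d) (Rep-reify (mk treeSig c↑ ts) d)
                   ; D c▹ zero ts d       → con▹₁ ts (reify (mk treeSig c▹ ts) d) (Rep-reify (mk treeSig c▹ ts) d)
                   ; D c▹ (suc zero) ts d → con▹₂ ts (reify (mk treeSig c▹ ts) d) (Rep-reify (mk treeSig c▹ ts) d) }
    }
    where
    resp : (g : T → T) (t u : Tree treeSig D) (d : Finite treeSig t) (e : Finite treeSig u) →
           _≈_ treeSig t u → _≈_ treeSig (embed (g (reify t d))) (embed (g (reify u e)))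
    resp g t u d e (h , _) = Rep⇒≈ _ (embed (g (reify t d))) (embed (g (reify u e))) (Rep-label _)
      (subst (λ x → Rep (label (g (reify u e))) (g x))
        (sym (Rep-unique _ _ (proj₁ u) (Rep-resp _ _ (proj₁ u) (Rep-reify t d) h) (Rep-reify u e)))
        (Rep-label _))

    -- The reified tree is abstracted to `x` so that its shape can be matched; the root label
    -- excludes the other constructors.
    con↑ : ∀ ts x → Rep (mkl treeSig {D} c↑ ts) x → _≈_ treeSig (embed (down x)) (ts zero)
    con↑ ts (↑ x) (_ , r) = Rep⇒≈ x (embed x) (ts zero) (Rep-label x) r

    con▹₁ : ∀ ts x → Rep (mkl treeSig {D} c▹ ts) x → _≈_ treeSig (embed (fst x)) (ts zero)
    con▹₁ ts (x ▹ y) (_ , r , _) = Rep⇒≈ x (embed x) (ts zero) (Rep-label x) r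

    con▹₂ : ∀ ts x → Rep (mkl treeSig {D} c▹ ts) x → _≈_ treeSig (embed (snd x)) (ts (suc zero))
    con▹₂ ts (x ▹ y) (_ , _ , r) = Rep⇒≈ y (embed y) (ts (suc zero)) (Rep-label y) r

  interprets : Interprets structure selectors
  interprets c↑ zero t d x r
    with refl ← Rep-unique _ _ (proj₁ t) r (Rep-reify t d) = Rep-label (down x)
  interprets c▹ zero t d x r
    with refl ← Rep-unique _ _ (proj₁ t) r (Rep-reify t d) = Rep-label (fst x)
  interprets c▹ (suc zero) t d x r
    with refl ← Rep-unique _ _ (proj₁ t) r (Rep-reify t d) = Rep-label (snd x)

  valid-elim : ∀ φ → Valid treeSig treeWF φ → SatT selectors emptyT φ
  valid-elim φ v = Transfer.Sat⇒SatT structure selectors interprets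
    (Semantics.empty treeSig treeWF structure) emptyT (λ ()) φ (v structure)

-- An abstract machine for partial recursive functions

-- A configuration is either p ▹ xs ▹ K (run p on xs with continuation K) or
-- ↑ (v ▹ K) (return v to K).  Lists are ▹-chains ending in ∙, numbers are ↑-chains;
-- programs and continuations are tagged by numerals.  Since 0 and the empty list
-- are both ∙, so are the programs for Z and for the empty vector.

nat : ℕ → T
nat zero    = ∙
nat (suc n) = ↑ nat n

list : ∀ {n} → Vec ℕ n → T
list []       = ∙
list (x ∷ xs) = nat x ▹ list xs

mutual
  prog : ∀ {n} → PRF n → T
  prog Z           = ∙
  prog S           = ↑ ∙
  -- Shifted by two, past the codes of `Z` and `S`.
  prog (proj i)    = ↑ ↑ nat (toℕ i)
  prog (comp f gs) = ↑ ∙ ▹ prog f ▹ progs gs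
  prog (prec g h)  = ↑ ↑ ∙ ▹ prog g ▹ prog h
  prog (mu f)      = ↑ ↑ ↑ ∙ ▹ prog f

  progs : ∀ {n m} → Vec (PRF n) m → T
  progs []       = ∙
  progs (g ∷ gs) = ∙ ▹ prog g ▹ progs gs

halt : ℕ → T
halt n = ↑ (nat n ▹ ∙)

-- Continuation tags 0 to 4 mean: evaluate the remaining programs, prepend a value, apply a function
-- to its arguments, continue a recursion, test a search candidate. The last clause fixes all other
-- configurations, among them every `halt n`.
step : T → T
step (∙ ▹ xs ▹ K)                                  = ↑ (∙ ▹ K)
step (↑ ∙ ▹ (x ▹ xs) ▹ K)                          = ↑ (↑ x ▹ K)
step (↑ ↑ ∙ ▹ (x ▹ xs) ▹ K)                        = ↑ (x ▹ K)
step (↑ ↑ ↑ i ▹ (x ▹ xs) ▹ K)                      = ↑ ↑ i ▹ xs ▹ K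
step ((∙ ▹ g ▹ gs) ▹ xs ▹ K)                       = g ▹ xs ▹ (∙ ▹ gs ▹ xs ▹ K)
step (↑ (y ▹ ∙ ▹ gs ▹ xs ▹ K))                     = gs ▹ xs ▹ (↑ ∙ ▹ y ▹ K)
step (↑ (ys ▹ ↑ ∙ ▹ y ▹ K))                        = ↑ ((y ▹ ys) ▹ K)
step ((↑ ∙ ▹ f ▹ gs) ▹ xs ▹ K)                     = gs ▹ xs ▹ (↑ ↑ ∙ ▹ f ▹ K)
step (↑ (ys ▹ ↑ ↑ ∙ ▹ f ▹ K))                      = f ▹ ys ▹ K
step ((↑ ↑ ∙ ▹ g ▹ h) ▹ (∙ ▹ xs) ▹ K)              = g ▹ xs ▹ K
step ((↑ ↑ ∙ ▹ g ▹ h) ▹ (↑ k ▹ xs) ▹ K)            = (↑ ↑ ∙ ▹ g ▹ h) ▹ (k ▹ xs) ▹ (↑ ↑ ↑ ∙ ▹ h ▹ (k ▹ xs) ▹ K)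
step (↑ (r ▹ ↑ ↑ ↑ ∙ ▹ h ▹ (k ▹ xs) ▹ K))          = h ▹ (k ▹ r ▹ xs) ▹ K
step ((↑ ↑ ↑ ∙ ▹ f) ▹ xs ▹ K)                      = f ▹ (∙ ▹ xs) ▹ (↑ ↑ ↑ ↑ ∙ ▹ f ▹ (∙ ▹ xs) ▹ K)
step (↑ (∙ ▹ ↑ ↑ ↑ ↑ ∙ ▹ f ▹ (z ▹ xs) ▹ K))        = ↑ (z ▹ K)
step (↑ (↑ k ▹ ↑ ↑ ↑ ↑ ∙ ▹ f ▹ (z ▹ xs) ▹ K))      = f ▹ (↑ z ▹ xs) ▹ (↑ ↑ ↑ ↑ ∙ ▹ f ▹ (↑ z ▹ xs) ▹ K)
step c                                             = c

-- The first argument is a clock. A clock not ending in `∙` yields `∙`, which differs from every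
-- `halt n`.
run : T → T → T
run ∙       c = c
run (↑ t)   c = run t (step c)
run (_ ▹ _) c = ∙

-- Once one clock has run out at a halting configuration, `step` no longer moves it, so the longer
-- run ends there too.
run-deterministic : ∀ t u c → run t c ≡ halt 1 → run u c ≡ halt 0 → ⊥
run-deterministic ∙     ∙     c refl ()
run-deterministic ∙     (↑ u) c refl e′   = run-deterministic ∙ u c refl e′
run-deterministic (↑ t) ∙     c e    refl = run-deterministic t ∙ c e refl
run-deterministic (↑ t) (↑ u) c e    e′   = run-deterministic t u (step c) e e′

-- The machine in the language of trees

infix  9 ↑ᵗ_
infixr 5 _▹ᵗ_

∙ᵗ : ∀ {Γ} → Tm Γ
∙ᵗ = con D c∙ []

↑ᵗ_ : ∀ {Γ} → Tm Γ → Tm Γ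
↑ᵗ a = con D c↑ (a ∷ [])

_▹ᵗ_ : ∀ {Γ} → Tm Γ → Tm Γ → Tm Γ
a ▹ᵗ b = con D c▹ (a ∷ b ∷ [])

runᵗ : ∀ {Γ} → Tm Γ → Tm Γ → Tm Γ
runᵗ t c = sel D c↑ zero (t ▹ᵗ c)

quoteᵗ : ∀ {Γ} → T → Tm Γ
quoteᵗ ∙       = ∙ᵗ
quoteᵗ (↑ x)   = ↑ᵗ quoteᵗ x
quoteᵗ (x ▹ y) = quoteᵗ x ▹ᵗ quoteᵗ y

eval-quote : ∀ I {Γ} (ρ : EnvT Γ) x → evalT I ρ (quoteᵗ x) ≡ x
eval-quote I ρ ∙       = refl
eval-quote I ρ (↑ x)   = cong ↑_ (eval-quote I ρ x)
eval-quote I ρ (x ▹ y) = cong₂ _▹_ (eval-quote I ρ x) (eval-quote I ρ y)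

x₀ : ∀ {Γ} → Tm (D ∷ Γ)
x₀ = var vz
x₁ : ∀ {Γ} → Tm (D ∷ D ∷ Γ)
x₁ = var (vs vz)
x₂ : ∀ {Γ} → Tm (D ∷ D ∷ D ∷ Γ)
x₂ = var (vs (vs vz))
x₃ : ∀ {Γ} → Tm (D ∷ D ∷ D ∷ D ∷ Γ)
x₃ = var (vs (vs (vs vz)))
x₄ : ∀ {Γ} → Tm (D ∷ D ∷ D ∷ D ∷ D ∷ Γ)
x₄ = var (vs (vs (vs (vs vz))))
x₅ : ∀ {Γ} → Tm (D ∷ D ∷ D ∷ D ∷ D ∷ D ∷ Γ)
x₅ = var (vs (vs (vs (vs (vs vz)))))

alls : ∀ {Γ} n → Form (replicate n D ++ Γ) → Form Γ
alls zero    φ = φ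
alls (suc n) φ = alls n (all D φ)

-- The innermost variable `x₀` is the clock; `x₁` to `xₙ` are the variables of the rule.
rule : ∀ {Γ} n → Tm (replicate (suc n) D ++ Γ) → Tm (replicate (suc n) D ++ Γ) → Form Γ
rule n lhs rhs = alls n (all D (eq D (runᵗ (↑ᵗ x₀) lhs) (runᵗ x₀ rhs)))

-- One conjunct for each clause of `step` in the same order, up to the final catch-all.
machine : ∀ {Γ} → Form Γ
machine =
  and (rule 2 (∙ᵗ ▹ᵗ x₂ ▹ᵗ x₁)
              (↑ᵗ (∙ᵗ ▹ᵗ x₁))) (
  and (rule 3 (↑ᵗ ∙ᵗ ▹ᵗ (x₃ ▹ᵗ x₂) ▹ᵗ x₁)
              (↑ᵗ (↑ᵗ x₃ ▹ᵗ x₁))) (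
  and (rule 3 (↑ᵗ ↑ᵗ ∙ᵗ ▹ᵗ (x₃ ▹ᵗ x₂) ▹ᵗ x₁)
              (↑ᵗ (x₃ ▹ᵗ x₁))) (
  and (rule 4 (↑ᵗ ↑ᵗ ↑ᵗ x₄ ▹ᵗ (x₃ ▹ᵗ x₂) ▹ᵗ x₁)
              (↑ᵗ ↑ᵗ x₄ ▹ᵗ x₂ ▹ᵗ x₁)) (
  and (rule 4 ((∙ᵗ ▹ᵗ x₄ ▹ᵗ x₃) ▹ᵗ x₂ ▹ᵗ x₁)
              (x₄ ▹ᵗ x₂ ▹ᵗ (∙ᵗ ▹ᵗ x₃ ▹ᵗ x₂ ▹ᵗ x₁))) (
  and (rule 4 (↑ᵗ (x₄ ▹ᵗ ∙ᵗ ▹ᵗ x₃ ▹ᵗ x₂ ▹ᵗ x₁))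
              (x₃ ▹ᵗ x₂ ▹ᵗ (↑ᵗ ∙ᵗ ▹ᵗ x₄ ▹ᵗ x₁))) (
  and (rule 3 (↑ᵗ (x₃ ▹ᵗ ↑ᵗ ∙ᵗ ▹ᵗ x₂ ▹ᵗ x₁))
              (↑ᵗ ((x₂ ▹ᵗ x₃) ▹ᵗ x₁))) (
  and (rule 4 ((↑ᵗ ∙ᵗ ▹ᵗ x₄ ▹ᵗ x₃) ▹ᵗ x₂ ▹ᵗ x₁)
              (x₃ ▹ᵗ x₂ ▹ᵗ (↑ᵗ ↑ᵗ ∙ᵗ ▹ᵗ x₄ ▹ᵗ x₁))) (
  and (rule 3 (↑ᵗ (x₃ ▹ᵗ ↑ᵗ ↑ᵗ ∙ᵗ ▹ᵗ x₂ ▹ᵗ x₁))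
              (x₂ ▹ᵗ x₃ ▹ᵗ x₁)) (
  and (rule 4 ((↑ᵗ ↑ᵗ ∙ᵗ ▹ᵗ x₄ ▹ᵗ x₃) ▹ᵗ (∙ᵗ ▹ᵗ x₂) ▹ᵗ x₁)
              (x₄ ▹ᵗ x₂ ▹ᵗ x₁)) (
  and (rule 5 ((↑ᵗ ↑ᵗ ∙ᵗ ▹ᵗ x₅ ▹ᵗ x₄) ▹ᵗ (↑ᵗ x₃ ▹ᵗ x₂) ▹ᵗ x₁)
              ((↑ᵗ ↑ᵗ ∙ᵗ ▹ᵗ x₅ ▹ᵗ x₄) ▹ᵗ (x₃ ▹ᵗ x₂) ▹ᵗ (↑ᵗ ↑ᵗ ↑ᵗ ∙ᵗ ▹ᵗ x₄ ▹ᵗ (x₃ ▹ᵗ x₂) ▹ᵗ x₁))) (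
  and (rule 5 (↑ᵗ (x₅ ▹ᵗ ↑ᵗ ↑ᵗ ↑ᵗ ∙ᵗ ▹ᵗ x₄ ▹ᵗ (x₃ ▹ᵗ x₂) ▹ᵗ x₁))
              (x₄ ▹ᵗ (x₃ ▹ᵗ x₅ ▹ᵗ x₂) ▹ᵗ x₁)) (
  and (rule 3 ((↑ᵗ ↑ᵗ ↑ᵗ ∙ᵗ ▹ᵗ x₃) ▹ᵗ x₂ ▹ᵗ x₁)
              (x₃ ▹ᵗ (∙ᵗ ▹ᵗ x₂) ▹ᵗ (↑ᵗ ↑ᵗ ↑ᵗ ↑ᵗ ∙ᵗ ▹ᵗ x₃ ▹ᵗ (∙ᵗ ▹ᵗ x₂) ▹ᵗ x₁))) (
  and (rule 4 (↑ᵗ (∙ᵗ ▹ᵗ ↑ᵗ ↑ᵗ ↑ᵗ ↑ᵗ ∙ᵗ ▹ᵗ x₄ ▹ᵗ (x₃ ▹ᵗ x₂) ▹ᵗ x₁))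
              (↑ᵗ (x₃ ▹ᵗ x₁)))
      (rule 5 (↑ᵗ (↑ᵗ x₅ ▹ᵗ ↑ᵗ ↑ᵗ ↑ᵗ ↑ᵗ ∙ᵗ ▹ᵗ x₄ ▹ᵗ (x₃ ▹ᵗ x₂) ▹ᵗ x₁))
              (x₄ ▹ᵗ (↑ᵗ x₃ ▹ᵗ x₂) ▹ᵗ (↑ᵗ ↑ᵗ ↑ᵗ ↑ᵗ ∙ᵗ ▹ᵗ x₄ ▹ᵗ (↑ᵗ x₃ ▹ᵗ x₂) ▹ᵗ x₁)))
  )))))))))))))

-- `run (↑ t) c` unfolds to `run t (step c)`, and the patterns of `step` match each left-hand side.
run-machine : ∀ {Γ} (ρ : EnvT Γ) → SatT (Freely.selectors run) ρ machine
run-machine ρ =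
  (λ _ _ _ → refl) , (λ _ _ _ _ → refl) , (λ _ _ _ _ → refl) , (λ _ _ _ _ _ → refl) ,
  (λ _ _ _ _ _ → refl) , (λ _ _ _ _ _ → refl) , (λ _ _ _ _ → refl) , (λ _ _ _ _ _ → refl) ,
  (λ _ _ _ _ → refl) , (λ _ _ _ _ _ → refl) , (λ _ _ _ _ _ _ → refl) , (λ _ _ _ _ _ _ → refl) ,
  (λ _ _ _ _ → refl) , (λ _ _ _ _ _ → refl) , (λ _ _ _ _ _ _ → refl)

-- Machine runs derived from the axioms

module Reachability (R : T → T → T) where

  infix 4 _⇝_
  -- Allowing every remaining clock `t` makes the relation compose; a step adds one `↑` to the
  -- clock.
  _⇝_ : T → T → Set
  c ⇝ c′ = ∀ t → ∃ λ t′ → R t′ c ≡ R t c′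

  ⇝-step : ∀ {c c′} → (∀ t → R (↑ t) c ≡ R t c′) → c ⇝ c′
  ⇝-step h t = ↑ t , h t

  infixr 4 _⨾_
  _⨾_ : ∀ {a b c} → a ⇝ b → b ⇝ c → a ⇝ c
  (p ⨾ q) t = let u , e = q t ; v , e′ = p u in v , trans e′ e

-- Induction on the evaluation derivation, for all continuations `K` at once, since subcomputations
-- run under longer ones.
machine-runs : ∀ I {Γ} (ρ : EnvT Γ) → SatT I ρ machine → ∀ {n} (p : PRF n) {xs y} → p [ xs ]⇓ y →
               ∀ K → Reachability._⇝_ (λ t c → I c↑ zero (t ▹ c)) (prog p ▹ list xs ▹ K) (↑ (nat y ▹ K))
machine-runs I ρ (rZ , rS , rProj₀ , rProj₊ , rCons , rHead , rTail , rComp , rApp ,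
                  rPrec₀ , rPrec₊ , rIter , rMu , rFound , rNext) = go
  where
  open Reachability (λ t c → I c↑ zero (t ▹ c))

  -- Induction on the distance `d` from the current candidate `z` to the least zero `y`; every
  -- smaller candidate returns a successor and triggers `rNext`.
  search : ∀ f xs y K →
           (f ▹ (nat y ▹ xs) ▹ (↑ ↑ ↑ ↑ ∙ ▹ f ▹ (nat y ▹ xs) ▹ K) ⇝ ↑ (nat y ▹ K)) →
           (∀ z → z < y → ∃ λ k → ∀ K → f ▹ (nat z ▹ xs) ▹ K ⇝ ↑ (nat (suc k) ▹ K)) →
           ∀ d z → d + z ≡ y → f ▹ (nat z ▹ xs) ▹ (↑ ↑ ↑ ↑ ∙ ▹ f ▹ (nat z ▹ xs) ▹ K) ⇝ ↑ (nat y ▹ K)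
  search f xs y K found below zero    z refl = found
  search f xs y K found below (suc d) z refl =
    let k , h = below z (s≤s (m≤n+m z d)) in
    h _ ⨾ ⇝-step (rNext (nat k) f (nat z) xs K) ⨾ search f xs y K found below d (suc z) (+-suc d z)

  projects : ∀ {n} (i : Fin n) xs K → ↑ ↑ nat (toℕ i) ▹ list xs ▹ K ⇝ ↑ (nat (lookup xs i) ▹ K)
  projects zero    (x ∷ xs) K = ⇝-step (rProj₀ (nat x) (list xs) K)
  projects (suc i) (x ∷ xs) K =
    ⇝-step (rProj₊ (nat (toℕ i)) (nat x) (list xs) K) ⨾ projects i xs K

  mutual
    go : ∀ {n} (p : PRF n) {xs y} → p [ xs ]⇓ y → ∀ K → prog p ▹ list xs ▹ K ⇝ ↑ (nat y ▹ K)
    go Z {xs} ev-Z K = ⇝-step (rZ (list xs) K)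
    go S (ev-S {x}) K = ⇝-step (rS (nat x) ∙ K)
    go (proj i) {xs} (ev-proj i) K = projects i xs K
    go (comp f gs) {xs} (ev-comp {ys = ys} ds d) K =
      ⇝-step (rComp (prog f) (progs gs) (list xs) K) ⨾
      goes gs ds _ ⨾
      ⇝-step (rApp (list ys) (prog f) K) ⨾
      go f d K
    go (prec g h) (ev-prec0 {xs = xs} d) K =
      ⇝-step (rPrec₀ (prog g) (prog h) (list xs) K) ⨾ go g d K
    go (prec g h) (ev-precS {xs = xs} {k} {r} d e) K =
      ⇝-step (rPrec₊ (prog g) (prog h) (nat k) (list xs) K) ⨾
      go (prec g h) d _ ⨾
      ⇝-step (rIter (nat r) (prog h) (nat k) (list xs) K) ⨾
      go h e K
    go (mu f) {xs} {y} (ev-mu d below) K =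
      ⇝-step (rMu (prog f) (list xs) K) ⨾
      search (prog f) (list xs) y K
        (go f d _ ⨾ ⇝-step (rFound (prog f) (nat y) (list xs) K))
        (λ z z<y → let k , e = below z z<y in k , go f e)
        y 0 (+-identityʳ y)

    goes : ∀ {n m} (gs : Vec (PRF n) m) {xs ys} → gs [ xs ]⇓* ys →
           ∀ K → progs gs ▹ list xs ▹ K ⇝ ↑ (list ys ▹ K)
    goes [] {xs} ev-nil K = ⇝-step (rZ (list xs) K)
    goes (g ∷ gs) {xs} (ev-cons {y = y} {ys} d ds) K =
      ⇝-step (rCons (prog g) (progs gs) (list xs) K) ⨾
      go g d _ ⨾
      ⇝-step (rHead (nat y) (progs gs) (list xs) K) ⨾
      goes gs ds _ ⨾
      ⇝-step (rTail (list ys) (nat y) K)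

-- The sentences expressing halting with output 0

initᵗ : ∀ {Γ} → PRF 1 → Tm Γ → Tm Γ
initᵗ G a = quoteᵗ (prog G) ▹ᵗ (a ▹ᵗ ∙ᵗ) ▹ᵗ ∙ᵗ

-- The free variable is the input. The axioms only equate values of `R` with each other, so output 0
-- is expressed by the value `R ∙ (halt 0)` and not by a fixed tree.
neverZero : PRF 1 → Form (D ∷ [])
neverZero G = and machine (all D (neg (eq D (runᵗ x₀ (initᵗ G x₁)) (runᵗ ∙ᵗ (quoteᵗ (halt 0))))))

-- The numeral is bound by a quantifier instead of substituted, so that the code of χ
-- occurs verbatim in the code of the instance; the instance negates χ.
instanceAt : ℕ → Form (D ∷ []) → Sentence treeSig
instanceAt n χ = all D (neg (and (eq D x₀ (quoteᵗ (nat n))) χ))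

zero⇒valid : ∀ G n → G [ n ∷ [] ]⇓ 0 → Valid treeSig treeWF (instanceAt n (neverZero G))
zero⇒valid G n d = valid-intro (instanceAt n (neverZero G)) λ { I x (e , ax , h) →
  -- The two final arguments are the empty continuation and the exhausted clock.
  let t , q = machine-runs I (singleT x) ax G d ∙ ∙ in
  h t (trans (cong₂ (λ p a → I c↑ zero (t ▹ p ▹ (a ▹ ∙) ▹ ∙))
                    (eval-quote I _ (prog G)) (trans e (eval-quote I _ (nat n)))) q) }

-- Since `run` satisfies the axioms, `machine-runs` applies to it and yields an actual run to
-- `halt 1`, which rules out one to `halt 0`.
one⇒invalid : ∀ G n → G [ n ∷ [] ]⇓ 1 → ¬ Valid treeSig treeWF (instanceAt n (neverZero G))
one⇒invalid G n d v =
  valid-elim (instanceAt n (neverZero G)) v (nat n)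
    ( sym (eval-quote I _ (nat n))
    , run-machine (singleT (nat n))
    , λ t e → let u , q = machine-runs I (singleT (nat n)) (run-machine (singleT (nat n))) G d ∙ ∙ in
        run-deterministic u t _ q
          (trans (cong (λ p → run t (p ▹ (nat n ▹ ∙) ▹ ∙)) (sym (eval-quote I _ (prog G)))) e) )
  where
  open Freely run
  I : Selectors
  I = selectors

-- Computing the code of an instance

constP : ∀ {n} → ℕ → PRF n
constP zero    = Z
constP (suc k) = comp S (constP k ∷ [])

constP-⇓ : ∀ {n} k {xs : Vec ℕ n} → constP k [ xs ]⇓ k
constP-⇓ zero    = ev-Z
constP-⇓ (suc k) = ev-comp (ev-cons (constP-⇓ k) ev-nil) ev-S

addP : PRF 2
addP = prec (proj zero) (comp S (proj (suc zero) ∷ []))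

addP-⇓ : ∀ a b → addP [ a ∷ b ∷ [] ]⇓ (a + b)
addP-⇓ zero    b = ev-prec0 (ev-proj zero)
addP-⇓ (suc a) b = ev-precS (addP-⇓ a b) (ev-comp (ev-cons (ev-proj (suc zero)) ev-nil) ev-S)

triP : PRF 1
triP = prec Z (comp addP (comp S (proj zero ∷ []) ∷ proj (suc zero) ∷ []))

triP-⇓ : ∀ k → triP [ k ∷ [] ]⇓ tri k
triP-⇓ zero    = ev-prec0 ev-Z
triP-⇓ (suc k) = ev-precS (triP-⇓ k)
  (ev-comp (ev-cons (ev-comp (ev-cons (ev-proj zero) ev-nil) ev-S) (ev-cons (ev-proj (suc zero)) ev-nil))
           (addP-⇓ (suc k) (tri k)))

pairP : ∀ {n} → PRF n → PRF n → PRF n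
pairP p q = comp addP (comp triP (comp addP (p ∷ q ∷ []) ∷ []) ∷ q ∷ [])

pairP-⇓ : ∀ {n} {p q : PRF n} {xs a b} → p [ xs ]⇓ a → q [ xs ]⇓ b → pairP p q [ xs ]⇓ pair a b
pairP-⇓ {a = a} {b} d e =
  ev-comp (ev-cons (ev-comp (ev-cons (ev-comp (ev-cons d (ev-cons e ev-nil)) (addP-⇓ a b)) ev-nil)
                            (triP-⇓ (a + b)))
                   (ev-cons e ev-nil))
          (addP-⇓ (tri (a + b)) b)

listP : ∀ {n} → List (PRF n) → PRF n
listP []       = Z
listP (p ∷ ps) = comp S (pairP p (listP ps) ∷ [])

nodeP : ∀ {n} → List (PRF n) → PRF n
nodeP ps = pairP (constP 1) (listP ps)

-- The index e keeps unification from ever comparing (huge) values of gn.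
record _[_]codes_ {n} (p : PRF n) (xs : Vec ℕ n) (e : SExp) : Set where
  constructor coded
  field evaluates : p [ xs ]⇓ gn e
open _[_]codes_

data _[_]codes*_ {n} : List (PRF n) → Vec ℕ n → List SExp → Set where
  []  : ∀ {xs} → [] [ xs ]codes* []
  _∷_ : ∀ {xs p ps e es} → p [ xs ]codes e → ps [ xs ]codes* es → (p ∷ ps) [ xs ]codes* (e ∷ es)

listP-⇓ : ∀ {n} {xs : Vec ℕ n} {ps es} → ps [ xs ]codes* es → listP ps [ xs ]⇓ gnList es
listP-⇓ []       = ev-Z
listP-⇓ (d ∷ ds) = ev-comp (ev-cons (pairP-⇓ (evaluates d) (listP-⇓ ds)) ev-nil) ev-S

nodeP-codes : ∀ {n} {xs : Vec ℕ n} {ps es} → ps [ xs ]codes* es → nodeP ps [ xs ]codes node es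
nodeP-codes ds = coded (pairP-⇓ (constP-⇓ 1) (listP-⇓ ds))

quoteP : ∀ {n} → SExp → PRF n
quoteP e = constP (gn e)

quoteP-codes : ∀ {n} {xs : Vec ℕ n} e → quoteP e [ xs ]codes e
quoteP-codes e = coded (constP-⇓ (gn e))

-- The step of a primitive recursion, whose second argument is the code of the previous numeral. The
-- atoms are the tag of `con`, the sort `D` and the index of `↑`.
sucP : PRF 2
sucP = nodeP (quoteP (atom 1) ∷ quoteP (atom 0) ∷ quoteP (atom 1) ∷ nodeP (proj (suc zero) ∷ []) ∷ [])

sucP-codes : ∀ {Γ} k (a : Tm Γ) →
             sucP [ k ∷ gn (encTerm treeSig a) ∷ [] ]codes encTerm treeSig (↑ᵗ a)
sucP-codes k a =
  nodeP-codes (quoteP-codes (atom 1) ∷ quoteP-codes (atom 0) ∷ quoteP-codes (atom 1) ∷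
               nodeP-codes (coded (ev-proj (suc zero)) ∷ []) ∷ [])

numeralP : PRF 1
numeralP = prec (quoteP (encTerm treeSig {[]} ∙ᵗ)) sucP

numeralP-codes : ∀ {Γ} n → numeralP [ n ∷ [] ]codes encTerm treeSig {Γ} (quoteᵗ (nat n))
numeralP-codes zero        = coded (ev-prec0 (evaluates (quoteP-codes (encTerm treeSig {[]} ∙ᵗ))))
numeralP-codes {Γ} (suc n) =
  coded (ev-precS (evaluates (numeralP-codes {Γ} n)) (evaluates (sucP-codes {Γ} n (quoteᵗ (nat n)))))

-- The input is used twice: `numeralP` turns it into the code of its numeral, and `proj zero`
-- inserts it unchanged as the code of the formula.
diagonalP : SExp → PRF 1
diagonalP sig =
  nodeP (quoteP sig ∷
         nodeP (quoteP (atom 3) ∷ quoteP (atom 0) ∷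
                nodeP (quoteP (atom 1) ∷
                       nodeP (quoteP (atom 2) ∷
                              nodeP (quoteP (atom 0) ∷ quoteP (atom 0) ∷
                                     quoteP (encTerm treeSig {D ∷ []} x₀) ∷ numeralP ∷ []) ∷
                              proj zero ∷ []) ∷ []) ∷ []) ∷ [])

diagonalP-codes : ∀ sig χ n → n ≡ gn (encFormula treeSig χ) →
                  diagonalP sig [ n ∷ [] ]codes node (sig ∷ encFormula treeSig (instanceAt n χ) ∷ [])
diagonalP-codes sig χ n e =
  nodeP-codes (quoteP-codes sig ∷
    nodeP-codes (quoteP-codes (atom 3) ∷ quoteP-codes (atom 0) ∷
      nodeP-codes (quoteP-codes (atom 1) ∷
        nodeP-codes (quoteP-codes (atom 2) ∷
          nodeP-codes (quoteP-codes (atom 0) ∷ quoteP-codes (atom 0) ∷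
            quoteP-codes (encTerm treeSig {D ∷ []} x₀) ∷ numeralP-codes n ∷ []) ∷
          coded (subst (proj zero [ n ∷ [] ]⇓_) e (ev-proj zero)) ∷ []) ∷ []) ∷ []) ∷ [])

-- Stated for a variable signature: for treeSig the conversion check would compute the code.
code-unfold : ∀ sig φ → code sig φ ≡ gn (node (encSig sig ∷ encFormula sig φ ∷ []))
code-unfold sig φ = refl

-- Diagonalisation against a decision procedure

theorem1 : ¬ Σ (PRF 1) DecidesTheory
theorem1 (f , decides) = contradiction _ refl
  where
  G : PRF 1
  G = comp f (diagonalP (encSig treeSig) ∷ [])

  G-⇓ : ∀ n {y} → n ≡ gn (encFormula treeSig (neverZero G)) →
        f [ code treeSig (instanceAt n (neverZero G)) ∷ [] ]⇓ y → G [ n ∷ [] ]⇓ y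
  G-⇓ n {y} e d =
    ev-comp (ev-cons (evaluates (diagonalP-codes (encSig treeSig) (neverZero G) n e)) ev-nil)
            (subst (λ c → f [ c ∷ [] ]⇓ y) (code-unfold treeSig (instanceAt n (neverZero G))) d)

  -- The code stays a variable with an equation, so that it is never computed.
  contradiction : ∀ n → n ≡ gn (encFormula treeSig (neverZero G)) → ⊥
  contradiction n e =
    let valid , invalid = decides treeSig treeWF (instanceAt n (neverZero G))
        -- Validity is refuted first, which avoids a case distinction on it; the verdict 0 then
        -- makes the instance valid after all.
        ¬valid = λ v → one⇒invalid G n (G-⇓ n e (valid v)) v
    in ¬valid (zero⇒valid G n (G-⇓ n e (invalid ¬valid)))
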